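{- Let $\varphi$ be a multi-agent formula, let $i\in G$, and let $\bigvee_{k\in K}\delta_k$ be a disjunctive normal form of $\varphi$ for agent $i$ in K45. For each $S\subseteq K$, let $B_S$ and $\Gamma_S$ be the sets of formulas $\beta$ and $\gamma$, respectively, such that $\Box_i\beta$, respectively $\Diamond_i\gamma$, occurs as a conjunct in $\bigwedge_{k\in S}\delta_k^{\Box_i\Diamond_i}$. Then, for each of the classes of frames $\mathcal{K}=$ KD45 and $\mathcal{K}=$ S5, the following are equivalent (all semantic notions being relative to $\mathcal{K}$): \begin{enumerate} \item[1.] $\varphi$ is unbelievable to $i$. \item[2.] $\varphi$ is unknowable to $i$. \item[3.] $\varphi\leftrightarrow(\varphi\land\lnot\Box_i\varphi)$ is valid. \item[4.] $\bigvee_{S\subseteq K}\left[\bigwedge_{k\in S}\delta_k^{\Box_i\Diamond_i}\land\Box_i\left(\bigvee_{k\in S}\delta_k^{\alpha}\right)\right]$ is unsatisfiable. \end{enumerate} In particular, if for all $S\subseteq K$ the formula $\bigvee_{k\in S}\delta_k^\alpha$ and all the formulas in $B_S$ and $\Gamma_S$ are $i$-independent, then condition (4) can be simplified to (i.e. is equivalent to): \begin{enumerate} \item[4'.] For any $S\subseteq K$, (i) $B_S\cup\{\bigvee_{k\in S}\delta_k^{\alpha}\}$ is unsatisfiable, or (ii) there exists a $\gamma\in\Gamma_S$ such that $B_S\cup\{\bigvee_{k\in S}\delta_k^{\alpha}\}\cup\{\gamma\}$ is unsatisfiable. \end{enumerate}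
   Context: $G$ is a set of agents. Multi-agent formulas are built from a set $\mathbf{Prop}$ of proposition letters by $\varphi:=p\mid\lnot\varphi\mid\varphi\land\psi\mid\Box_i\varphi$ ($i\in G$), with other connectives and $\Diamond_i=\lnot\Box_i\lnot$ as abbreviations, interpreted in Kripke models $M=(W,\{R_i\}_{i\in G},V)$ as usual. KD45: every $R_i$ is serial, transitive and Euclidean. S5: every $R_i$ is an equivalence relation. K45: every $R_i$ is transitive and Euclidean. A formula or set of formulas is satisfiable in a class of frames if it is (jointly) true at some state of some model based on a frame in the class; valid means true at all states of all such models. $\varphi$ is believable to $i$ in $\mathcal{K}$ iff $\Box_i\varphi$ is satisfiable in $\mathcal{K}$; knowable to $i$ in $\mathcal{K}$ iff $\varphi\land\Box_i\varphi$ is satisfiable in $\mathcal{K}$. Unbelievable means not believable; unknowable means not knowable. A formula is $i$-objective iff none of its top (outermost) modal operators is $\Box_i$ or $\Diamond_i$. A formula is $i$-independent iff it contains neither $\Box_i$ nor $\Diamond_i$ (anywhere). A disjunctive normal form for $i$ ($i$-DNF) in K45 is a (finite) disjunction $\bigvee_{k\in K}\delta_k$ of conjunctions of the form $\delta\equiv\alpha\land\Box_i\beta_1\land\cdots\land\Box_i\beta_n\land\Diamond_i\gamma_1\land\cdots\land\Diamond_i\gamma_m$, where $\alpha$ and each $\gamma_j$ are conjunctions of $i$-objective formulas and each $\beta_j$ is a disjunction of $i$-objective formulas; it is a disjunctive normal form of $\varphi$ for $i$ in K45 if it is logically equivalent to $\varphi$ in K45. For such $\delta$, write $\delta^\alpha\equiv\alpha$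 and $\delta^{\Box_i\Diamond_i}\equiv\Box_i\beta_1\land\cdots\land\Box_i\beta_n\land\Diamond_i\gamma_1\land\cdots\land\Diamond_i\gamma_m$. Empty disjunctions are $\bot$ and empty conjunctions are $\top$. -}

module Defs where

open import Data.Bool.Base using (Bool; true; false; T)
open import Data.Fin.Base using (Fin)
open import Data.Fin.Subset using (Subset) renaming (_∈_ to _∈ₛ_)
open import Data.Fin.Subset.Properties using (_∈?_)
open import Data.List.Base using (List; []; _∷_; _++_; map; filter; allFin)
open import Data.List.Membership.Propositional using () renaming (_∈_ to _∈ₗ_)
open import Data.List.Membership.Propositional.Properties using (∈-map⁺; ∈-++⁺ˡ; ∈-++⁺ʳ)
open import Data.List.Relation.Unary.All using (All)
open import Data.List.Relation.Unary.Any using (here)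
open import Data.Nat.Base using (ℕ; zero; suc)
open import Data.Product.Base using (_×_; Σ-syntax; ∃-syntax)
open import Data.Sum.Base using (_⊎_)
open import Data.Unit.Base using (⊤)
open import Data.Vec.Base as Vec using ()
open import Level using (0ℓ)
open import Relation.Binary.Core using (Rel)
open import Relation.Binary.Definitions using (Transitive)
open import Relation.Binary.PropositionalEquality.Core using (_≡_; _≢_; refl)
open import Relation.Binary.Structures using (IsEquivalence)
open import Relation.Nullary using (¬_)
open import Relation.Unary using (Pred; _∈_; _∪_; ｛_｝)

-- The letter p₀ serves only to define ⊥ and ⊤ as abbreviations. Asking for one
-- costs no generality: the grammar yields no formula unless some letter exists.
record Language : Set₁ where
  field
    Agent  : Set
    Letter : Set
    p₀     : Letter

open Language public

infix  9 ∼_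
infixr 7 _∧_

data Formula (L : Language) : Set where
  var : Letter L → Formula L
  ∼_  : Formula L → Formula L
  _∧_ : Formula L → Formula L → Formula L
  □   : Agent L → Formula L → Formula L

module _ {L : Language} where

  infixr 6 _∨_
  infixr 5 _⟹_
  infix  4 _⟺_

  ◇ : Agent L → Formula L → Formula L
  ◇ i φ = ∼ □ i (∼ φ)

  _∨_ _⟹_ _⟺_ : Formula L → Formula L → Formula L
  φ ∨ ψ = ∼ (∼ φ ∧ ∼ ψ)
  φ ⟹ ψ = ∼ (φ ∧ ∼ ψ)
  φ ⟺ ψ = (φ ⟹ ψ) ∧ (ψ ⟹ φ)

  ⊥ᶠ ⊤ᶠ : Formula L
  ⊥ᶠ = var (p₀ L) ∧ ∼ var (p₀ L)
  ⊤ᶠ = ∼ ⊥ᶠ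

  ⋀ ⋁ : List (Formula L) → Formula L
  ⋀ []            = ⊤ᶠ
  ⋀ (φ ∷ [])      = φ
  ⋀ (φ ∷ ψ ∷ φs)  = φ ∧ ⋀ (ψ ∷ φs)
  ⋁ []            = ⊥ᶠ
  ⋁ (φ ∷ [])      = φ
  ⋁ (φ ∷ ψ ∷ φs)  = φ ∨ ⋁ (ψ ∷ φs)

record Frame (L : Language) : Set₁ where
  field
    World : Set
    R     : Agent L → Rel World 0ℓ

open Frame public

-- Valuations take values in Bool; as formulas are built with ∼, ∧ and □ only,
-- truth at a world is then stable under double negation.
record Model (L : Language) : Set₁ where
  field
    frame : Frame L
    V     : Letter L → World frame → Bool

open Model public

infix 3 _at_⊨_

_at_⊨_ : ∀ {L} (M : Model L) → World (frame M) → Formula L → Set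
M at w ⊨ var p   = T (V M p w)
M at w ⊨ ∼ φ     = ¬ (M at w ⊨ φ)
M at w ⊨ (φ ∧ ψ) = (M at w ⊨ φ) × (M at w ⊨ ψ)
M at w ⊨ □ i φ   = ∀ v → R (frame M) i w v → M at v ⊨ φ

Serial Euclidean : {W : Set} → Rel W 0ℓ → Set
Serial    _~_ = ∀ x → ∃[ y ] x ~ y
Euclidean _~_ = ∀ {x y z} → x ~ y → x ~ z → y ~ z

FrameClass : Language → Set₁
FrameClass L = Pred (Frame L) 0ℓ

module _ {L : Language} where

  K45 KD45 S5 : FrameClass L
  K45  F = ∀ i → Transitive (R F i) × Euclidean (R F i)
  KD45 F = ∀ i → Serial (R F i) × Transitive (R F i) × Euclidean (R F i)
  S5   F = ∀ i → IsEquivalence (R F i)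

  SatisfiableSet : FrameClass L → Pred (Formula L) 0ℓ → Set₁
  SatisfiableSet 𝒦 Φ =
    Σ[ M ∈ Model L ] (frame M ∈ 𝒦) × (∃[ w ] (∀ φ → φ ∈ Φ → M at w ⊨ φ))

  Satisfiable : FrameClass L → Formula L → Set₁
  Satisfiable 𝒦 φ = Σ[ M ∈ Model L ] (frame M ∈ 𝒦) × (∃[ w ] M at w ⊨ φ)

  Valid : FrameClass L → Formula L → Set₁
  Valid 𝒦 φ = (M : Model L) → frame M ∈ 𝒦 → ∀ w → M at w ⊨ φ

  Believable Knowable : FrameClass L → Agent L → Formula L → Set₁
  Believable 𝒦 i φ = Satisfiable 𝒦 (□ i φ)
  Knowable   𝒦 i φ = Satisfiable 𝒦 (φ ∧ □ i φ)

  -- ◇ j φ unfolds to ∼ □ j (∼ φ), so the □ clauses below also govern ◇.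

  Objective : Agent L → Formula L → Set
  Objective i (var p) = ⊤
  Objective i (∼ φ)   = Objective i φ
  Objective i (φ ∧ ψ) = Objective i φ × Objective i ψ
  Objective i (□ j φ) = j ≢ i

  Independent : Agent L → Formula L → Set
  Independent i (var p) = ⊤
  Independent i (∼ φ)   = Independent i φ
  Independent i (φ ∧ ψ) = Independent i φ × Independent i ψ
  Independent i (□ j φ) = j ≢ i × Independent i φ

-- Each list in αs and γss is read conjunctively, each list in βss disjunctively.
record Disjunct (L : Language) (i : Agent L) : Set where
  field
    αs    : List (Formula L)
    βss   : List (List (Formula L))
    γss   : List (List (Formula L))
    α-obj : All (Objective i) αs
    β-obj : All (All (Objective i)) βss
    γ-obj : All (All (Objective i)) γss

  α : Formula L
  α = ⋀ αs

  βs γs : List (Formula L)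
  βs = map ⋁ βss
  γs = map ⋀ γss

  modalConjuncts : List (Formula L)
  modalConjuncts = map (□ i) βs ++ map (◇ i) γs

  □◇-part : Formula L
  □◇-part = ⋀ modalConjuncts

  formula : Formula L
  formula = ⋀ (α ∷ modalConjuncts)

elements : ∀ {n} → Subset n → List (Fin n)
elements {n} S = filter (_∈? S) (allFin n)

subsets : ∀ n → List (Subset n)
subsets zero    = Vec.[] ∷ []
subsets (suc n) = map (true Vec.∷_) (subsets n) ++ map (false Vec.∷_) (subsets n)

∈-subsets : ∀ {n} (S : Subset n) → S ∈ₗ subsets n
∈-subsets Vec.[]            = here refl
∈-subsets (true  Vec.∷ S)   = ∈-++⁺ˡ (∈-map⁺ (true Vec.∷_) (∈-subsets S))
∈-subsets (false Vec.∷ S)   =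
  ∈-++⁺ʳ (map (true Vec.∷_) (subsets _)) (∈-map⁺ (false Vec.∷_) (∈-subsets S))

module _ {L : Language} {i : Agent L} {n : ℕ} (δ : Fin n → Disjunct L i) where
  open Disjunct

  IsDNFOf : Formula L → Set₁
  IsDNFOf φ = Valid K45 (φ ⟺ ⋁ (map (λ k → formula (δ k)) (allFin n)))

  ⋁α : Subset n → Formula L
  ⋁α S = ⋁ (map (λ k → α (δ k)) (elements S))

  ⋀□◇ : Subset n → Formula L
  ⋀□◇ S = ⋀ (map (λ k → □◇-part (δ k)) (elements S))

  B Γ : Subset n → Pred (Formula L) 0ℓ
  B S β = ∃[ k ] (k ∈ₛ S) × (β ∈ₗ βs (δ k))
  Γ S γ = ∃[ k ] (k ∈ₛ S) × (γ ∈ₗ γs (δ k))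

  beliefNF : Formula L
  beliefNF = ⋁ (map (λ S → ⋀□◇ S ∧ □ i (⋁α S)) (subsets n))

  AllIndependent : Set
  AllIndependent = ∀ S →
    Independent i (⋁α S) ×
    (∀ β → β ∈ B S → Independent i β) ×
    (∀ γ → γ ∈ Γ S → Independent i γ)

  EachSubsetUnsatisfiable : FrameClass L → Set₁
  EachSubsetUnsatisfiable 𝒦 = ∀ S →
    (¬ SatisfiableSet 𝒦 (B S ∪ ｛ ⋁α S ｝)) ⊎
    (∃[ γ ] (γ ∈ Γ S) × (¬ SatisfiableSet 𝒦 (B S ∪ ｛ ⋁α S ｝ ∪ ｛ γ ｝)))

{-# OPTIONS --safe #-}
module Submission where

-- The equivalences rest on two facts about transitive Euclidean frames.
--
-- First, a formula □ i ψ or ◇ i ψ has the same truth value at w and at every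
-- i-successor of w (`modal-invariant`). Hence, if φ is equivalent to the
-- disjunction of the δ k, then □ i φ is equivalent at every world of every K45
-- model to `beliefNF δ` (`belief⇔NF`). From right to left: if the modal parts of
-- all δ k with k ∈ S hold at w and i believes ⋁α S there, each successor v
-- satisfies some α (δ k) with k ∈ S and inherits the modal part of that δ k, so
-- δ k, and hence φ, holds at v. From left to right: take for S the set of those k
-- whose modal part holds at w; each successor satisfies φ, hence some δ k, and
-- the modal part of that δ k can be pulled back to w, so that k ∈ S.
--
-- Second, in a serial transitive frame any successor of a world where □ i φ holds
-- is a world where φ ∧ □ i φ holds. So unbelievable and unknowable formulas
-- coincide, and unknowability is a propositional reformulation of the validity of
-- φ ⟺ (φ ∧ ∼ □ i φ).
--
-- For the i-independent case, suppose that for some S neither alternative holds.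
-- Then there is a pointed model of B S ∪ { ⋁α S }, and for every γ ∈ Γ S one that
-- moreover satisfies γ. In the disjoint union of these models replace the relation
-- of i by the one that links all the distinguished points to each other and every
-- other world to itself only (`Glue`). This does not affect i-independent formulas
-- (`glue-truth`), and at a distinguished point the disjunct of `beliefNF δ` for S
-- is true. Conversely, from a world where this disjunct holds, seriality gives a
-- successor refuting the first alternative and the conjuncts ◇ i γ give successors
-- refuting the second.
--
-- Truth at a world is stable under double negation, so classical case
-- distinctions, in particular the choice of S, are harmless when proving the truth
-- of a formula. Excluded middle proper is used only in the independent case: to
-- decide which alternative holds for S, to obtain the models to glue, and to decide
-- whether an agent equals i.

open import Defs
open import Axiom.ExcludedMiddle using (ExcludedMiddle)
open import Data.Bool.Properties using (T?)
open import Data.Empty using (⊥-elim)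
open import Data.Fin.Base using (Fin)
open import Data.Fin.Properties using (sequence)
open import Data.Fin.Subset using (Subset) renaming (_∈_ to _∈ₛ_)
open import Data.Fin.Subset.Properties using (_∈?_)
open import Data.List.Base using (List; []; _∷_; map; allFin)
open import Data.List.Membership.Propositional using () renaming (_∈_ to _∈ₗ_)
open import Data.List.Membership.Propositional.Properties
  using (∈-map⁺; ∈-map⁻; ∈-++⁺ˡ; ∈-++⁺ʳ; ∈-++⁻; ∈-filter⁺; ∈-filter⁻; ∈-allFin)
open import Data.List.Relation.Unary.Any using (here; there)
open import Data.Maybe.Base using (Maybe; just; nothing)
open import Data.Nat.Base using (ℕ)
open import Data.Product.Base using (_×_; _,_; proj₁; proj₂; Σ; Σ-syntax; ∃-syntax; map₂)
open import Data.Sum.Base using (_⊎_; inj₁; inj₂)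
open import Data.Vec.Base using (tabulate)
open import Data.Vec.Properties using (lookup∘tabulate; lookup⇒[]=; []=⇒lookup)
open import Effect.Monad using (RawMonad)
open import Function.Base using (_∘_)
open import Function.Bundles using (_⇔_; mk⇔; module Equivalence)
open import Function.Properties.Equivalence using () renaming (sym to ⇔-sym; trans to ⇔-trans)
open import Level using (0ℓ; lift; lower) renaming (suc to lsuc)
open import Relation.Binary.Definitions using (Reflexive; Symmetric; Transitive)
open import Relation.Binary.PropositionalEquality.Core
  using (_≡_; _≢_; refl; sym; trans)
open import Relation.Binary.Structures using (IsEquivalence)
open import Relation.Nullary using (¬_; Dec; yes; no; does; contradiction)
open import Relation.Nullary.Decidable
  using (map′; decidable-stable; dec-true; ¬¬-excluded-middle)
open import Relation.Nullary.Negation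
  using (contraposition; negated-stable; ¬¬-map; ¬¬-Monad)
open import Relation.Unary using (Pred; _∈_; _∪_; ｛_｝)

open Equivalence using (to; from)

lowerEM : ∀ {ℓ} → ExcludedMiddle (lsuc ℓ) → ExcludedMiddle ℓ
lowerEM {ℓ} em = map′ lower (lift {ℓ = lsuc ℓ}) em

¬-cong-⇔ : ∀ {a b} {A : Set a} {B : Set b} → A ⇔ B → (¬ A) ⇔ (¬ B)
¬-cong-⇔ A⇔B = mk⇔ (contraposition (from A⇔B)) (contraposition (to A⇔B))

-- Up to double negation, every predicate on a finite set has an extension.
¬¬-comprehension : ∀ {n} (P : Pred (Fin n) 0ℓ) →
                   ¬ ¬ (Σ[ S ∈ Subset n ] (∀ k → (k ∈ₛ S) ⇔ P k))
¬¬-comprehension {n} P =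
  ¬¬-map extension (sequence (RawMonad.rawApplicative ¬¬-Monad) (λ _ → ¬¬-excluded-middle))
  where
  extension : (∀ k → Dec (P k)) → Σ[ S ∈ Subset n ] (∀ k → (k ∈ₛ S) ⇔ P k)
  extension P? = tabulate (does ∘ P?) , λ k → mk⇔ (sound k) (complete k)
    where
    sound : ∀ k → k ∈ₛ tabulate (does ∘ P?) → P k
    sound k k∈S with P? k | trans (sym (lookup∘tabulate (does ∘ P?) k)) ([]=⇒lookup k∈S)
    ... | yes p | _ = p
    complete : ∀ k → P k → k ∈ₛ tabulate (does ∘ P?)
    complete k p = lookup⇒[]= k _ (trans (lookup∘tabulate (does ∘ P?) k) (dec-true (P? k) p))

∈-elements : ∀ {n} {S : Subset n} {k} → (k ∈ₗ elements S) ⇔ (k ∈ₛ S)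
∈-elements {S = S} {k} =
  mk⇔ (λ k∈ → proj₂ (∈-filter⁻ (_∈? S) {xs = allFin _} k∈))
      (∈-filter⁺ (_∈? S) {xs = allFin _} (∈-allFin k))

-- Truth of the derived connectives

module _ {L : Language} (M : Model L) where

  stable : ∀ φ {w} → ¬ ¬ (M at w ⊨ φ) → M at w ⊨ φ
  stable (var p) {w} h = decidable-stable (T? (V M p w)) h
  stable (∼ φ)       h = negated-stable h
  stable (φ ∧ ψ)     h = stable φ (¬¬-map proj₁ h) , stable ψ (¬¬-map proj₂ h)
  stable (□ i φ)     h = λ v Rwv → stable φ (¬¬-map (λ □φ → □φ v Rwv) h)

  ⟺-elim : ∀ φ ψ {w} → M at w ⊨ (φ ⟺ ψ) → (M at w ⊨ φ) ⇔ (M at w ⊨ ψ)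
  ⟺-elim φ ψ (φ⟹ψ , ψ⟹φ) =
    mk⇔ (λ hφ → stable ψ (λ ¬ψ → φ⟹ψ (hφ , ¬ψ)))
        (λ hψ → stable φ (λ ¬φ → ψ⟹φ (hψ , ¬φ)))

  ⋀⁺ : ∀ φs {w} → (∀ {φ} → φ ∈ₗ φs → M at w ⊨ φ) → M at w ⊨ ⋀ φs
  ⋀⁺ []           h = λ (p , ¬p) → ¬p p
  ⋀⁺ (φ ∷ [])     h = h (here refl)
  ⋀⁺ (φ ∷ ψ ∷ φs) h = h (here refl) , ⋀⁺ (ψ ∷ φs) (h ∘ there)

  ⋀⁻ : ∀ φs {w} → M at w ⊨ ⋀ φs → ∀ {φ} → φ ∈ₗ φs → M at w ⊨ φ
  ⋀⁻ (φ ∷ [])     h        (here refl) = h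
  ⋀⁻ (φ ∷ ψ ∷ φs) (h , hs) (here refl) = h
  ⋀⁻ (φ ∷ ψ ∷ φs) (h , hs) (there φ∈)  = ⋀⁻ (ψ ∷ φs) hs φ∈

  ⋁⁺ : ∀ φs {w φ} → φ ∈ₗ φs → M at w ⊨ φ → M at w ⊨ ⋁ φs
  ⋁⁺ (φ ∷ [])     (here refl) h = h
  ⋁⁺ (φ ∷ ψ ∷ φs) (here refl) h = λ (¬φ , _) → ¬φ h
  ⋁⁺ (φ ∷ ψ ∷ φs) (there φ∈)  h = λ (_ , ¬φs) → ¬φs (⋁⁺ (ψ ∷ φs) φ∈ h)

  ⋁⁻ : ∀ φs {w} → M at w ⊨ ⋁ φs → ¬ ¬ (∃[ φ ] (φ ∈ₗ φs) × (M at w ⊨ φ))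
  ⋁⁻ []           (p , ¬p) _ = ¬p p
  ⋁⁻ (φ ∷ [])     h        k = k (φ , here refl , h)
  ⋁⁻ (φ ∷ ψ ∷ φs) h        k =
    h ((λ hφ → k (φ , here refl , hφ)) ,
       (λ hs → ⋁⁻ (ψ ∷ φs) hs (λ (χ , χ∈ , hχ) → k (χ , there χ∈ , hχ))))

  module _ {A : Set} (f : A → Formula L) (xs : List A) where

    ⋀-map⁺ : ∀ {w} → (∀ {x} → x ∈ₗ xs → M at w ⊨ f x) → M at w ⊨ ⋀ (map f xs)
    ⋀-map⁺ {w} h = ⋀⁺ (map f xs) onImage
      where
      onImage : ∀ {φ} → φ ∈ₗ map f xs → M at w ⊨ φ
      onImage φ∈ with ∈-map⁻ f φ∈
      ... | x , x∈ , refl = h x∈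

    ⋀-map⁻ : ∀ {w x} → M at w ⊨ ⋀ (map f xs) → x ∈ₗ xs → M at w ⊨ f x
    ⋀-map⁻ h x∈ = ⋀⁻ (map f xs) h (∈-map⁺ f x∈)

    ⋁-map⁺ : ∀ {w x} → x ∈ₗ xs → M at w ⊨ f x → M at w ⊨ ⋁ (map f xs)
    ⋁-map⁺ x∈ h = ⋁⁺ (map f xs) (∈-map⁺ f x∈) h

    ⋁-map⁻ : ∀ {w} → M at w ⊨ ⋁ (map f xs) → ¬ ¬ (∃[ x ] (x ∈ₗ xs) × (M at w ⊨ f x))
    ⋁-map⁻ {w} h = ¬¬-map preimage (⋁⁻ (map f xs) h)
      where
      preimage : ∃[ φ ] (φ ∈ₗ map f xs) × (M at w ⊨ φ) → ∃[ x ] (x ∈ₗ xs) × (M at w ⊨ f x)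
      preimage (φ , φ∈ , hφ) with ∈-map⁻ f φ∈
      ... | x , x∈ , refl = x , x∈ , hφ

-- Disjuncts and their modal parts

module _ {L : Language} {i : Agent L} (d : Disjunct L i) (M : Model L) where
  open Disjunct d

  □◇-part⁺ : ∀ {w} → (∀ {β} → β ∈ₗ βs → M at w ⊨ □ i β) →
             (∀ {γ} → γ ∈ₗ γs → M at w ⊨ ◇ i γ) → M at w ⊨ □◇-part
  □◇-part⁺ {w} hβ hγ = ⋀⁺ M modalConjuncts conjunct
    where
    conjunct : ∀ {χ} → χ ∈ₗ modalConjuncts → M at w ⊨ χ
    conjunct χ∈ with ∈-++⁻ (map (□ i) βs) χ∈
    ... | inj₁ χ∈□ with ∈-map⁻ (□ i) χ∈□
    ...   | β , β∈ , refl = hβ β∈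
    conjunct χ∈ | inj₂ χ∈◇ with ∈-map⁻ (◇ i) χ∈◇
    ...   | γ , γ∈ , refl = hγ γ∈

  □◇-part⇒□ : ∀ {w β} → M at w ⊨ □◇-part → β ∈ₗ βs → M at w ⊨ □ i β
  □◇-part⇒□ h β∈ = ⋀⁻ M modalConjuncts h (∈-++⁺ˡ (∈-map⁺ (□ i) β∈))

  □◇-part⇒◇ : ∀ {w γ} → M at w ⊨ □◇-part → γ ∈ₗ γs → M at w ⊨ ◇ i γ
  □◇-part⇒◇ h γ∈ = ⋀⁻ M modalConjuncts h (∈-++⁺ʳ (map (□ i) βs) (∈-map⁺ (◇ i) γ∈))

  formula⇔α×□◇ : ∀ {w} →
    (M at w ⊨ formula) ⇔ ((M at w ⊨ α) × (M at w ⊨ □◇-part))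
  formula⇔α×□◇ {w} = mk⇔
    (λ h → let conjunct = ⋀⁻ M (α ∷ modalConjuncts) h in
           conjunct (here refl) , ⋀⁺ M modalConjuncts (conjunct ∘ there))
    (λ (hα , hm) → ⋀⁺ M (α ∷ modalConjuncts) λ
      { (here refl) → hα
      ; (there χ∈)  → ⋀⁻ M modalConjuncts hm χ∈ })

-- Belief in a formula in disjunctive normal form

module _ {L : Language} (M : Model L) (k45 : frame M ∈ K45) {i : Agent L} where

  □-invariant : ∀ ψ {w v} → R (frame M) i w v → (M at w ⊨ □ i ψ) ⇔ (M at v ⊨ □ i ψ)
  □-invariant ψ Rwv = mk⇔
    (λ □ψ u Rvu → □ψ u (proj₁ (k45 i) Rwv Rvu))
    (λ □ψ u Rwu → □ψ u (proj₂ (k45 i) Rwv Rwu))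

  modal-invariant : ∀ (d : Disjunct L i) {w v} → R (frame M) i w v →
    (M at w ⊨ Disjunct.□◇-part d) ⇔ (M at v ⊨ Disjunct.□◇-part d)
  modal-invariant d Rwv = mk⇔
    (λ h → □◇-part⁺ d M
      (λ {β} β∈ → to (□-invariant β Rwv) (□◇-part⇒□ d M h β∈))
      (λ {γ} γ∈ → to (¬-cong-⇔ (□-invariant (∼ γ) Rwv)) (□◇-part⇒◇ d M h γ∈)))
    (λ h → □◇-part⁺ d M
      (λ {β} β∈ → from (□-invariant β Rwv) (□◇-part⇒□ d M h β∈))
      (λ {γ} γ∈ → from (¬-cong-⇔ (□-invariant (∼ γ) Rwv)) (□◇-part⇒◇ d M h γ∈)))

module _ {L : Language} {i : Agent L} {n : ℕ} (δ : Fin n → Disjunct L i) where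
  open Disjunct

  -- The disjunct of the belief normal form for the index set S.
  beliefDisjunct : Subset n → Formula L
  beliefDisjunct S = ⋀□◇ δ S ∧ □ i (⋁α δ S)

  module _ (M : Model L) where

    ⋀□◇⇔ : ∀ {w} S →
      (M at w ⊨ ⋀□◇ δ S) ⇔ (∀ k → k ∈ₛ S → M at w ⊨ □◇-part (δ k))
    ⋀□◇⇔ S = mk⇔
      (λ h k k∈S → ⋀-map⁻ M (□◇-part ∘ δ) (elements S) h (from ∈-elements k∈S))
      (λ h → ⋀-map⁺ M (□◇-part ∘ δ) (elements S) (λ {k} k∈ → h k (to ∈-elements k∈)))

    beliefNF⁻ : ∀ {w} → M at w ⊨ beliefNF δ → ¬ ¬ (∃[ S ] (M at w ⊨ beliefDisjunct S))
    beliefNF⁻ h = ¬¬-map (map₂ proj₂) (⋁-map⁻ M beliefDisjunct (subsets n) h)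

    beliefNF⁺ : ∀ {w} S → M at w ⊨ beliefDisjunct S → M at w ⊨ beliefNF δ
    beliefNF⁺ S h = ⋁-map⁺ M beliefDisjunct (subsets n) (∈-subsets S) h

  belief⇔NF : ∀ φ → IsDNFOf δ φ → (M : Model L) → frame M ∈ K45 → ∀ w →
              (M at w ⊨ □ i φ) ⇔ (M at w ⊨ beliefNF δ)
  belief⇔NF φ dnf M k45 w = mk⇔ belief⇒NF NF⇒belief
    where
    φ⇔DNF : ∀ v → (M at v ⊨ φ) ⇔ (M at v ⊨ ⋁ (map (formula ∘ δ) (allFin n)))
    φ⇔DNF v = ⟺-elim M φ (⋁ (map (formula ∘ δ) (allFin n))) (dnf M k45 v)

    NF⇒belief : M at w ⊨ beliefNF δ → M at w ⊨ □ i φ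
    NF⇒belief nf v Rwv = stable M φ λ ¬φ →
      beliefNF⁻ M nf λ (S , modal , □⋁α) →
      ⋁-map⁻ M (α ∘ δ) (elements S) (□⋁α v Rwv) λ (k , k∈ , hα) →
      ¬φ (from (φ⇔DNF v)
        (⋁-map⁺ M (formula ∘ δ) (allFin n) (∈-allFin k)
          (from (formula⇔α×□◇ (δ k) M)
            (hα , to (modal-invariant M k45 (δ k) Rwv)
                     (to (⋀□◇⇔ M S) modal k (to ∈-elements k∈))))))

    belief⇒NF : M at w ⊨ □ i φ → M at w ⊨ beliefNF δ
    belief⇒NF □φ = stable M (beliefNF δ) λ ¬nf →
      ¬¬-comprehension (λ k → M at w ⊨ □◇-part (δ k)) λ (S , S⇔) →
      ¬nf (beliefNF⁺ M S
        ( from (⋀□◇⇔ M S) (λ k → to (S⇔ k))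
        , λ v Rwv → stable M (⋁α δ S) λ ¬⋁α →
            ⋁-map⁻ M (formula ∘ δ) (allFin n) (to (φ⇔DNF v) (□φ v Rwv)) λ (k , _ , hδ) →
            let hα , modal = to (formula⇔α×□◇ (δ k) M) hδ
                k∈S        = from (S⇔ k) (from (modal-invariant M k45 (δ k) Rwv) modal)
            in ¬⋁α (⋁-map⁺ M (α ∘ δ) (elements S) (from ∈-elements k∈S) hα)))

-- Believability and knowability

module _ {L : Language} where

  S5⊆KD45 : ∀ {F : Frame L} → F ∈ S5 → F ∈ KD45
  S5⊆KD45 s5 j =
    (λ x → x , E.refl) , E.trans , (λ xy xz → E.trans (E.sym xy) xz)
    where module E = IsEquivalence (s5 j)

  module _ {𝒦 : FrameClass L} (𝒦⊆KD45 : ∀ {F} → F ∈ 𝒦 → F ∈ KD45) (i : Agent L) where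

    believable⇔knowable : ∀ φ → Believable 𝒦 i φ ⇔ Knowable 𝒦 i φ
    believable⇔knowable φ = mk⇔ successor (λ (M , M∈ , w , _ , □φ) → M , M∈ , w , □φ)
      where
      successor : Believable 𝒦 i φ → Knowable 𝒦 i φ
      successor (M , M∈ , w , □φ) =
        let serial , transitive , _ = 𝒦⊆KD45 M∈ i
            v , Rwv = serial w
        in M , M∈ , v , □φ v Rwv , (λ u Rvu → □φ u (transitive Rwv Rvu))

    believable⇔NF-satisfiable : ∀ φ {n} (δ : Fin n → Disjunct L i) → IsDNFOf δ φ →
      Believable 𝒦 i φ ⇔ Satisfiable 𝒦 (beliefNF δ)
    believable⇔NF-satisfiable φ δ dnf = mk⇔
      (λ (M , M∈ , w , h) → M , M∈ , w , to   (belief⇔NF δ φ dnf M (k45 M∈) w) h)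
      (λ (M , M∈ , w , h) → M , M∈ , w , from (belief⇔NF δ φ dnf M (k45 M∈) w) h)
      where
      k45 : ∀ {F} → F ∈ 𝒦 → F ∈ K45
      k45 F∈ j = proj₂ (𝒦⊆KD45 F∈ j)

  unknowable⇔valid : ∀ (𝒦 : FrameClass L) i φ →
    (¬ Knowable 𝒦 i φ) ⇔ Valid 𝒦 (φ ⟺ (φ ∧ ∼ □ i φ))
  unknowable⇔valid 𝒦 i φ = mk⇔
    (λ unknowable M M∈ w →
      (λ (hφ , ¬rhs) → ¬rhs (hφ , λ □φ → unknowable (M , M∈ , w , hφ , □φ))) ,
      (λ ((hφ , _) , ¬φ) → ¬φ hφ))
    (λ valid (M , M∈ , w , hφ , □φ) →
      proj₁ (valid M M∈ w) (hφ , λ (_ , ¬□φ) → ¬□φ □φ))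

-- Gluing pointed models along the relation of one agent

-- Disjoint union of the pointed models (M x , pt x), except that agent i cannot
-- distinguish the points from each other and has perfect information elsewhere.
-- As `Link` only records whether j equals i, decidability of this equality is needed
-- for seriality and reflexivity alone.
module Glue {L : Language} (i : Agent L) {I : Set} (M : I → Model L)
            (pt : ∀ x → World (frame (M x))) where

  World⊎ : Set
  World⊎ = Σ[ x ∈ I ] World (frame (M x))

  data Link (j : Agent L) : World⊎ → World⊎ → Set where
    within : ∀ {x u v} → j ≢ i → R (frame (M x)) j u v → Link j (x , u) (x , v)
    loop   : ∀ {a} → j ≡ i → Link j a a
    across : ∀ {x y u v} → j ≡ i → u ≡ pt x → v ≡ pt y → Link j (x , u) (y , v)

  glued : Model L
  glued = record
    { frame = record { World = World⊎ ; R = Link }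
    ; V     = λ p (x , u) → V (M x) p u
    }

  glue-truth : ∀ ψ → Independent i ψ → ∀ {x u} → (M x at u ⊨ ψ) ⇔ (glued at (x , u) ⊨ ψ)
  glue-truth (var p) _         = mk⇔ (λ h → h) (λ h → h)
  glue-truth (∼ ψ)   ind       = ¬-cong-⇔ (glue-truth ψ ind)
  glue-truth (ψ ∧ χ) (iψ , iχ) = mk⇔
    (λ (hψ , hχ) → to (glue-truth ψ iψ) hψ , to (glue-truth χ iχ) hχ)
    (λ (hψ , hχ) → from (glue-truth ψ iψ) hψ , from (glue-truth χ iχ) hχ)
  glue-truth (□ j ψ) (j≢i , iψ) {x} {u} = mk⇔ up
    (λ h v Ruv → from (glue-truth ψ iψ) (h (x , v) (within j≢i Ruv)))
    where
    up : M x at u ⊨ □ j ψ → glued at (x , u) ⊨ □ j ψ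
    up h _ (within _ Ruv)   = to (glue-truth ψ iψ) (h _ Ruv)
    up h _ (loop j≡i)       = contradiction j≡i j≢i
    up h _ (across j≡i _ _) = contradiction j≡i j≢i

  link-transitive : ∀ {j} → (∀ x → Transitive (R (frame (M x)) j)) → Transitive (Link j)
  link-transitive t (loop _)         q                = q
  link-transitive t p                (loop _)         = p
  link-transitive t (within j≢i r)   (within _ s)     = within j≢i (t _ r s)
  link-transitive t (across j≡i p _) (across _ _ q)   = across j≡i p q
  link-transitive t (within j≢i _)   (across j≡i _ _) = contradiction j≡i j≢i
  link-transitive t (across j≡i _ _) (within j≢i _)   = contradiction j≡i j≢i

  link-euclidean : ∀ {j} → (∀ x → Euclidean (R (frame (M x)) j)) → Euclidean (Link j)
  link-euclidean e (loop _)         q                = q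
  link-euclidean e (across j≡i p q) (loop _)         = across j≡i q p
  link-euclidean e (across j≡i _ p) (across _ _ q)   = across j≡i p q
  link-euclidean e (across j≡i _ _) (within j≢i _)   = contradiction j≡i j≢i
  link-euclidean e (within j≢i r)   (within _ s)     = within j≢i (e _ r s)
  link-euclidean e (within j≢i _)   (loop j≡i)       = contradiction j≡i j≢i
  link-euclidean e (within j≢i _)   (across j≡i _ _) = contradiction j≡i j≢i

  link-symmetric : ∀ {j} → (∀ x → Symmetric (R (frame (M x)) j)) → Symmetric (Link j)
  link-symmetric s (within j≢i r)   = within j≢i (s _ r)
  link-symmetric s (loop j≡i)       = loop j≡i
  link-symmetric s (across j≡i p q) = across j≡i q p

  module _ (_≟i : ∀ j → Dec (j ≡ i)) where

    link-serial : ∀ {j} → (∀ x → Serial (R (frame (M x)) j)) → Serial (Link j)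
    link-serial {j} s (x , u) with j ≟i
    ... | yes j≡i = (x , u) , loop j≡i
    ... | no  j≢i = let v , Ruv = s x u in (x , v) , within j≢i Ruv

    link-reflexive : ∀ {j} → (∀ x → Reflexive (R (frame (M x)) j)) → Reflexive (Link j)
    link-reflexive {j} r with j ≟i
    ... | yes j≡i = loop j≡i
    ... | no  j≢i = within j≢i (r _)

    glued-KD45 : (∀ x → frame (M x) ∈ KD45) → frame glued ∈ KD45
    glued-KD45 kd45 j =
      link-serial (λ x → proj₁ (kd45 x j)) ,
      link-transitive (λ x → proj₁ (proj₂ (kd45 x j))) ,
      link-euclidean (λ x → proj₂ (proj₂ (kd45 x j)))

    glued-S5 : (∀ x → frame (M x) ∈ S5) → frame glued ∈ S5
    glued-S5 s5 j = record
      { refl  = link-reflexive (λ x → IsEquivalence.refl (s5 x j))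
      ; sym   = link-symmetric (λ x → IsEquivalence.sym (s5 x j))
      ; trans = link-transitive (λ x → IsEquivalence.trans (s5 x j))
      }

-- The case of independent formulas

-- Closure of a class of frames under gluing along the relation of i.
GlueClosed : ∀ {L} → Agent L → FrameClass L → Set₁
GlueClosed {L} i 𝒦 = {I : Set} (M : I → Model L) (pt : ∀ x → World (frame (M x))) →
  (∀ x → frame (M x) ∈ 𝒦) → frame (Glue.glued i M pt) ∈ 𝒦

module _ {L : Language} {i : Agent L} {n : ℕ} (δ : Fin n → Disjunct L i)
         {𝒦 : FrameClass L} where
  open Disjunct

  -- The first alternative is refuted at a successor given by seriality, the second
  -- at a successor given by ◇ i γ.
  eachSubset⇒NF-unsatisfiable : (∀ {F} → F ∈ 𝒦 → F ∈ KD45) →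
    EachSubsetUnsatisfiable δ 𝒦 → ¬ Satisfiable 𝒦 (beliefNF δ)
  eachSubset⇒NF-unsatisfiable 𝒦⊆KD45 unsat (M , M∈ , w , nf) =
    beliefNF⁻ δ M nf λ (S , modal , □⋁α) → refute S modal □⋁α (unsat S)
    where
    module _ (S : Subset n) (modal : M at w ⊨ ⋀□◇ δ S) (□⋁α : M at w ⊨ □ i (⋁α δ S)) where
      atSuccessor : ∀ {v} → R (frame M) i w v →
                    ∀ ψ → ψ ∈ B δ S ∪ ｛ ⋁α δ S ｝ → M at v ⊨ ψ
      atSuccessor Rwv ψ (inj₁ (k , k∈S , ψ∈)) =
        □◇-part⇒□ (δ k) M (to (⋀□◇⇔ δ M S) modal k k∈S) ψ∈ _ Rwv
      atSuccessor Rwv ψ (inj₂ refl) = □⋁α _ Rwv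

      refute : ¬ ((¬ SatisfiableSet 𝒦 (B δ S ∪ ｛ ⋁α δ S ｝)) ⊎
                  (∃[ γ ] (γ ∈ Γ δ S) × (¬ SatisfiableSet 𝒦 (B δ S ∪ ｛ ⋁α δ S ｝ ∪ ｛ γ ｝))))
      refute (inj₁ unsatS) =
        let v , Rwv = proj₁ (𝒦⊆KD45 M∈ i) w
        in unsatS (M , M∈ , v , atSuccessor Rwv)
      refute (inj₂ (γ , (k , k∈S , γ∈) , unsatγ)) =
        □◇-part⇒◇ (δ k) M (to (⋀□◇⇔ δ M S) modal k k∈S) γ∈ λ v Rwv hγ →
        unsatγ (M , M∈ , v , λ
          { ψ (inj₁ ψ∈)          → atSuccessor Rwv ψ (inj₁ ψ∈)
          ; ψ (inj₂ (inj₁ ψ≡))   → atSuccessor Rwv ψ (inj₂ ψ≡)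
          ; ψ (inj₂ (inj₂ refl)) → hγ })

  -- The models to glue: one for B S and ⋁α S alone, which provides the point at
  -- which the disjunct is evaluated even if Γ S is empty, and one for each
  -- γ ∈ Γ S, which witnesses ◇ i γ.
  glue-satisfies-NF : GlueClosed i 𝒦 → AllIndependent δ → ∀ S →
    SatisfiableSet 𝒦 (B δ S ∪ ｛ ⋁α δ S ｝) →
    (∀ γ → γ ∈ Γ δ S → SatisfiableSet 𝒦 (B δ S ∪ ｛ ⋁α δ S ｝ ∪ ｛ γ ｝)) →
    Satisfiable 𝒦 (beliefNF δ)
  glue-satisfies-NF closed indep S (M₀ , M₀∈ , w₀ , h₀) satΓ =
    G.glued , closed M pt M∈ , (nothing , w₀) ,
    beliefNF⁺ δ G.glued S
      ( from (⋀□◇⇔ δ G.glued S) (λ k k∈S → □◇-part⁺ (δ k) G.glued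
          (λ {β} β∈ → □-intro β (proj₁ (proj₂ (indep S)) β (k , k∈S , β∈))
                                (λ x → base x β (inj₁ (k , k∈S , β∈))))
          (λ {γ} γ∈ → ◇-intro γ (k , k∈S , γ∈)))
      , □-intro (⋁α δ S) (proj₁ (indep S)) (λ x → base x (⋁α δ S) (inj₂ refl)) )
    where
    I : Set
    I = Maybe (Σ (Formula L) (_∈ Γ δ S))

    M : I → Model L
    M nothing         = M₀
    M (just (γ , γ∈)) = proj₁ (satΓ γ γ∈)

    M∈ : ∀ x → frame (M x) ∈ 𝒦
    M∈ nothing         = M₀∈
    M∈ (just (γ , γ∈)) = proj₁ (proj₂ (satΓ γ γ∈))

    pt : ∀ x → World (frame (M x))
    pt nothing         = w₀
    pt (just (γ , γ∈)) = proj₁ (proj₂ (proj₂ (satΓ γ γ∈)))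

    base : ∀ x ψ → ψ ∈ B δ S ∪ ｛ ⋁α δ S ｝ → M x at pt x ⊨ ψ
    base nothing         ψ ψ∈        = h₀ ψ ψ∈
    base (just (γ , γ∈)) ψ (inj₁ ψ∈) = proj₂ (proj₂ (proj₂ (satΓ γ γ∈))) ψ (inj₁ ψ∈)
    base (just (γ , γ∈)) ψ (inj₂ ψ≡) = proj₂ (proj₂ (proj₂ (satΓ γ γ∈))) ψ (inj₂ (inj₁ ψ≡))

    module G = Glue i M pt

    □-intro : ∀ ψ → Independent i ψ → (∀ x → M x at pt x ⊨ ψ) →
              G.glued at (nothing , w₀) ⊨ □ i ψ
    □-intro ψ ind h _       (G.within i≢i _)    = contradiction refl i≢i
    □-intro ψ ind h _       (G.loop _)          = to (G.glue-truth ψ ind) (h nothing)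
    □-intro ψ ind h (x , _) (G.across _ _ refl) = to (G.glue-truth ψ ind) (h x)

    ◇-intro : ∀ γ → γ ∈ Γ δ S → G.glued at (nothing , w₀) ⊨ ◇ i γ
    ◇-intro γ γ∈ □∼γ =
      □∼γ (just (γ , γ∈) , pt (just (γ , γ∈))) (G.across refl refl refl)
        (to (G.glue-truth γ (proj₂ (proj₂ (indep S)) γ γ∈))
            (proj₂ (proj₂ (proj₂ (satΓ γ γ∈))) γ (inj₂ (inj₂ refl))))

  NF-unsatisfiable⇒eachSubset : ExcludedMiddle (lsuc 0ℓ) → GlueClosed i 𝒦 →
    AllIndependent δ → ¬ Satisfiable 𝒦 (beliefNF δ) → EachSubsetUnsatisfiable δ 𝒦
  NF-unsatisfiable⇒eachSubset em closed indep unsat S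
    with em {SatisfiableSet 𝒦 (B δ S ∪ ｛ ⋁α δ S ｝)}
  ... | no  unsatS = inj₁ unsatS
  ... | yes satS
    with em {∃[ γ ] (γ ∈ Γ δ S) × (¬ SatisfiableSet 𝒦 (B δ S ∪ ｛ ⋁α δ S ｝ ∪ ｛ γ ｝))}
  ...   | yes unsatγ = inj₂ unsatγ
  ...   | no  allSat = ⊥-elim (unsat (glue-satisfies-NF closed indep S satS
            (λ γ γ∈ → decidable-stable em (λ unsatγ → allSat (γ , γ∈ , unsatγ)))))

theorem4 : {L : Language} (φ : Formula L) (i : Agent L)
    {n : ℕ} (δ : Fin n → Disjunct L i) → IsDNFOf δ φ →
    (𝒦 : FrameClass L) → (𝒦 ≡ KD45) ⊎ (𝒦 ≡ S5) →
    ((¬ Believable 𝒦 i φ) ⇔ (¬ Knowable 𝒦 i φ)) ×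
    ((¬ Knowable 𝒦 i φ) ⇔ Valid 𝒦 (φ ⟺ (φ ∧ ∼ □ i φ))) ×
    (Valid 𝒦 (φ ⟺ (φ ∧ ∼ □ i φ)) ⇔ (¬ Satisfiable 𝒦 (beliefNF δ))) ×
    (AllIndependent δ → ExcludedMiddle (lsuc 0ℓ) →
    ((¬ Satisfiable 𝒦 (beliefNF δ)) ⇔ EachSubsetUnsatisfiable δ 𝒦))
theorem4 {L} φ i δ dnf 𝒦 KD45⊎S5 =
  unbelievable⇔unknowable , unknowable⇔validity ,
  ⇔-trans (⇔-sym unknowable⇔validity) (⇔-trans (⇔-sym unbelievable⇔unknowable)
    (¬-cong-⇔ (believable⇔NF-satisfiable 𝒦⊆KD45 i φ δ dnf))) ,
  λ indep em → mk⇔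
    (NF-unsatisfiable⇒eachSubset δ em (glueClosed KD45⊎S5 em) indep)
    (eachSubset⇒NF-unsatisfiable δ 𝒦⊆KD45)
  where
  inKD45 : ∀ {𝒦} → (𝒦 ≡ KD45) ⊎ (𝒦 ≡ S5) → ∀ {F : Frame L} → F ∈ 𝒦 → F ∈ KD45
  inKD45 (inj₁ refl)     F∈ = F∈
  inKD45 (inj₂ refl) {F} F∈ = S5⊆KD45 {F = F} F∈

  𝒦⊆KD45 : ∀ {F} → F ∈ 𝒦 → F ∈ KD45
  𝒦⊆KD45 = inKD45 KD45⊎S5

  glueClosed : ∀ {𝒦 : FrameClass L} → (𝒦 ≡ KD45) ⊎ (𝒦 ≡ S5) →
               ExcludedMiddle (lsuc 0ℓ) → GlueClosed i 𝒦
  glueClosed (inj₁ refl) em M pt = Glue.glued-KD45 i M pt (λ _ → lowerEM em)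
  glueClosed (inj₂ refl) em M pt = Glue.glued-S5 i M pt (λ _ → lowerEM em)

  unbelievable⇔unknowable : (¬ Believable 𝒦 i φ) ⇔ (¬ Knowable 𝒦 i φ)
  unbelievable⇔unknowable = ¬-cong-⇔ (believable⇔knowable 𝒦⊆KD45 i φ)

  unknowable⇔validity : (¬ Knowable 𝒦 i φ) ⇔ Valid 𝒦 (φ ⟺ (φ ∧ ∼ □ i φ))
  unknowable⇔validity = unknowable⇔valid 𝒦 i φ
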